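{- Let $w\in\{\mathtt a,\mathtt b\}^n$ with $|w|_{\mathtt a}>0$. Then the cardinality of the $\sim_{3/2}$-class of $w$ in $\{\mathtt a,\mathtt b\}^n$ is $$\#[w]_{\sim_{3/2}}=\sum_{i=0}^{|w|_{\mathtt a}-1}[q^{\,|w|_{\mathtt a}\operatorname{strip}(w)+i}]\binom{n}{|w|_{\mathtt a}}_{\!q}.$$
   Context: $|w|_{\mathtt a}$ is the number of letters $\mathtt a$ in $w$ and $\binom{w}{\mathtt{ab}}$ the number of occurrences of $\mathtt{ab}$ as a scattered subword of $w$. Set $\operatorname{strip}(w)=\lfloor\binom{w}{\mathtt{ab}}/|w|_{\mathtt a}\rfloor$ if $|w|_{\mathtt a}>0$, and $0$ if $|w|_{\mathtt a}=0$. For $u,w\in\{\mathtt a,\mathtt b\}^n$, $u\sim_{3/2}w$ iff $|u|_{\mathtt a}=|w|_{\mathtt a}$ and $\operatorname{strip}(u)=\operatorname{strip}(w)$. The Gaussian binomial coefficient is the polynomial $\binom{c}{d}_q=\prod_{i=1}^d\frac{1-q^{c-d+i}}{1-q^i}$ for $0\le d\le c$; $[q^k]f$ is the coefficient of $q^k$ in $f$. -}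

module Defs where

import Algebra.Properties.Semiring.Sum as Sum
open import Data.Bool.Base using (if_then_else_)
open import Data.Fin.Base as Fin using (Fin; toℕ)
import Data.Fin.Properties as Fin
open import Data.Integer.Base using (ℤ; 0ℤ; 1ℤ; _-_; _*_)
open import Data.Integer.Properties using (+-*-semiring)
open import Data.List.Base using (allFin; cartesianProduct; filter; length)
open import Data.Nat.Base as ℕ using (ℕ; zero; suc; _∸_)
open import Data.Nat.Divisibility using (_∣?_)
open import Data.Nat.DivMod using (_/_)
import Data.Nat.Properties as ℕ
open import Data.Product.Base using (_×_; _,_; ∃)
open import Data.Vec.Base using (Vec; count; lookup)
open import Function.Bundles using (_↔_)
open import Level using (0ℓ)
open import Relation.Binary.Definitions using (DecidableEquality)
open import Relation.Binary.PropositionalEquality.Core using (_≡_; refl)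
open import Relation.Nullary.Decidable using (yes; no; does; _×-dec_)
open import Relation.Unary using (Pred; Decidable)

data Letter : Set where
  a b : Letter

_≟_ : DecidableEquality Letter
a ≟ a = yes refl
a ≟ b = no λ ()
b ≟ a = no λ ()
b ≟ b = yes refl

Word : ℕ → Set
Word = Vec Letter

∣_∣ₐ : ∀ {n} → Word n → ℕ
∣ w ∣ₐ = count (a ≟_) w

-- An occurrence of ab as a scattered subword is a pair of positions i < j
-- carrying the letters a and b respectively.
IsOccurrence : ∀ {n} → Word n → Pred (Fin n × Fin n) 0ℓ
IsOccurrence w (i , j) = i Fin.< j × lookup w i ≡ a × lookup w j ≡ b

isOccurrence? : ∀ {n} (w : Word n) → Decidable (IsOccurrence w)
isOccurrence? w (i , j) =
  (i Fin.<? j) ×-dec (lookup w i ≟ a) ×-dec (lookup w j ≟ b)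

binom-ab : ∀ {n} → Word n → ℕ
binom-ab {n} w =
  length (filter (isOccurrence? w) (cartesianProduct (allFin n) (allFin n)))

strip : ∀ {n} → Word n → ℕ
strip w with ∣ w ∣ₐ
... | zero  = 0
... | suc m = binom-ab w / suc m

infix 4 _∼_

_∼_ : ∀ {n} → Word n → Word n → Set
u ∼ w = ∣ u ∣ₐ ≡ ∣ w ∣ₐ × strip u ≡ strip w

[_]∼ : ∀ {n} → Word n → Set
[ w ]∼ = ∃ λ u → u ∼ w

HasCardinality : Set → ℕ → Set
HasCardinality A N = Fin N ↔ A

open Sum +-*-semiring public using (sum-syntax)

-- ℤ[[q]], a series being given by its coefficients.  The quotients in the
-- Gaussian binomial are computed here: ℤ[q] embeds in ℤ[[q]], in which each
-- 1 - qⁱ with i ≥ 1 is invertible, so the coefficients of a quotient that is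
-- a polynomial are those of the series.
Series : Set
Series = ℕ → ℤ

infix 8 [q^_]_

[q^_]_ : ℕ → Series → ℤ
[q^ k ] f = f k

q^_ : ℕ → Series
(q^ m) k = if does (k ℕ.≟ m) then 1ℤ else 0ℤ

infixl 7 _·_

_·_ : Series → Series → Series
(f · g) k = ∑[ i < suc k ] (f (toℕ i) * g (k ∸ toℕ i))

1-q^_ : ℕ → Series
(1-q^ m) k = (q^ 0) k - (q^ m) k

-- The geometric series 1 + qⁱ + q²ⁱ + ⋯, inverse to 1 - qⁱ when i ≥ 1.
1/[1-q^_] : ℕ → Series
1/[1-q^ i ] k = if does (i ∣? k) then 1ℤ else 0ℤ

-- The product f 1 · f 2 · ⋯ · f d.
∏[1⋯_] : ℕ → (ℕ → Series) → Series
∏[1⋯ zero  ] f = q^ 0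
∏[1⋯ suc d ] f = ∏[1⋯ d ] f · f (suc d)

-- Meaningful only for d ≤ c, because of the truncated subtraction.
gaussian : ℕ → ℕ → Series
gaussian c d = ∏[1⋯ d ] λ i → (1-q^ (c ∸ d ℕ.+ i)) · 1/[1-q^ i ]

{-# OPTIONS --safe #-}

-- Reading words from their first letter shows that binom-ab has on the words
-- with e letters b and d letters a the generating function P(e,d) determined by
--   P(e+1,d+1) = q^(e+1) P(e+1,d) + P(e,d+1),
-- since a leading a forms an occurrence of ab with every b.  P also satisfies
--   P(e+1,d+1) = P(e+1,d) + q^(d+1) P(e,d+1),
-- and both recurrences together give (1-q^(d+1)) P(e,d+1) = (1-q^(e+d+1)) P(e,d),
-- the ratio of consecutive Gaussian binomials.  A word u with m = |u|ₐ > 0 has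
-- strip s exactly when binom-ab u is one of ms, ms+1, …, ms+m-1.
module Submission where

open import Defs
import Algebra.Properties.Semiring.Sum as Sum
open import Data.Bool.Base using (true; false; if_then_else_)
open import Data.Fin.Base as Fin using (Fin; toℕ)
import Data.Fin.Properties as Fin
open import Data.Integer.Base as ℤ using (ℤ; +_; 0ℤ; 1ℤ)
import Data.Integer.Properties as ℤ
open import Data.Integer.Tactic.RingSolver using (solve-∀)
open import Data.List.Base as List using (allFin; cartesianProduct; filter; length)
import Data.List.Properties as List
open import Data.Nat.Base using (ℕ; zero; suc; _+_; _*_; _∸_; _≤_; _<_; s≤s; z<s)
open import Data.Nat.Divisibility using (_∣?_; ∣-refl; ∣m∣n⇒∣m+n; ∣m+n∣m⇒∣n; >⇒∤; m∣m*n)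
open import Data.Nat.DivMod using (_/_; _%_; m≡m%n+[m/n]*n; m%n<n; m*n/n≡m; m<n⇒m/n≡0;
  +-distrib-/-∣ˡ)
import Data.Nat.Properties as ℕ
open import Data.Product.Base using (∃; _×_; _,_)
open import Data.Sum.Base using (_⊎_; inj₁; inj₂)
open import Data.Sum.Function.Propositional using (_⊎-↔_)
open import Data.Vec.Base using ([]; _∷_; count; lookup)
open import Function.Base using (_∘_)
open import Function.Bundles using (_↔_; mk↔ₛ′; mk⇔)
open import Function.Construct.Composition using (_↔-∘_)
open import Level using (0ℓ)
open import Relation.Binary.PropositionalEquality
open import Relation.Nullary using (Dec; yes; no; Irrelevant; contradiction)
open import Relation.Nullary.Decidable using (does; does-⇔; dec-true; dec-false; _×-dec_)
open import Relation.Unary using (Pred; Decidable)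

open ≡-Reasoning
open Sum ℤ.+-*-semiring using (sum-cong-≗; ∑-distrib-+; sum-replicate-zero)

-- Arithmetic of power series: shifts and Cauchy products.

infixl 6 _⊕_ _⊖_

_⊕_ _⊖_ : Series → Series → Series
(f ⊕ g) k = f k ℤ.+ g k
(f ⊖ g) k = f k ℤ.- g k

-- This is multiplication by the monomial q^m, by recursion on the exponent so that coefficients
-- compute without a sum.
shift : ℕ → Series → Series
shift zero    f k       = f k
shift (suc m) f zero    = 0ℤ
shift (suc m) f (suc k) = shift m f k

shift-cong : ∀ m {f g} → f ≗ g → shift m f ≗ shift m g
shift-cong zero    f≗g k       = f≗g k
shift-cong (suc m) f≗g zero    = refl
shift-cong (suc m) f≗g (suc k) = shift-cong m f≗g k

shift-⊕ : ∀ m f g → shift m (f ⊕ g) ≗ shift m f ⊕ shift m g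
shift-⊕ zero    f g k       = refl
shift-⊕ (suc m) f g zero    = refl
shift-⊕ (suc m) f g (suc k) = shift-⊕ m f g k

shift-0 : ∀ m k → shift m (λ _ → 0ℤ) k ≡ 0ℤ
shift-0 zero    k       = refl
shift-0 (suc m) zero    = refl
shift-0 (suc m) (suc k) = shift-0 m k

shift-shift : ∀ m n f → shift m (shift n f) ≗ shift (m + n) f
shift-shift zero    n f k       = refl
shift-shift (suc m) n f zero    = refl
shift-shift (suc m) n f (suc k) = shift-shift m n f k

shift-q^ : ∀ m n → shift m (q^ n) ≗ q^ (m + n)
shift-q^ zero    n k       = refl
shift-q^ (suc m) n zero    = refl
shift-q^ (suc m) n (suc k) = shift-q^ m n k

·-cong : ∀ {f f′ g g′} → f ≗ f′ → g ≗ g′ → f · g ≗ f′ · g′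
·-cong f≗f′ g≗g′ k = sum-cong-≗ {suc k} λ i → cong₂ ℤ._*_ (f≗f′ (toℕ i)) (g≗g′ (k ∸ toℕ i))

∑-distrib-- : ∀ {n} (f g : ℕ → ℤ) →
  ∑[ i < n ] (f (toℕ i) ℤ.- g (toℕ i)) ≡ ∑[ i < n ] f (toℕ i) ℤ.- ∑[ i < n ] g (toℕ i)
∑-distrib-- {zero}  f g = refl
∑-distrib-- {suc n} f g = trans
  (cong (λ x → f 0 ℤ.- g 0 ℤ.+ x) (∑-distrib-- {n} (f ∘ suc) (g ∘ suc)))
  (lemma (f 0) (g 0) (∑[ i < n ] f (suc (toℕ i))) (∑[ i < n ] g (suc (toℕ i))))
  where
  lemma : ∀ w x y z → w ℤ.- x ℤ.+ (y ℤ.- z) ≡ (w ℤ.+ y) ℤ.- (x ℤ.+ z)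
  lemma = solve-∀

·-distribˡ-⊖ : ∀ f g h → f · (g ⊖ h) ≗ (f · g) ⊖ (f · h)
·-distribˡ-⊖ f g h k = trans
  (sum-cong-≗ {suc k} λ i → lemma (f (toℕ i)) (g (k ∸ toℕ i)) (h (k ∸ toℕ i)))
  (∑-distrib-- {suc k} (λ i → f i ℤ.* g (k ∸ i)) (λ i → f i ℤ.* h (k ∸ i)))
  where
  lemma : ∀ x y z → x ℤ.* (y ℤ.- z) ≡ x ℤ.* y ℤ.- x ℤ.* z
  lemma = solve-∀

·-distribʳ-⊖ : ∀ h f g → (f ⊖ g) · h ≗ (f · h) ⊖ (g · h)
·-distribʳ-⊖ h f g k = trans
  (sum-cong-≗ {suc k} λ i → lemma (f (toℕ i)) (g (toℕ i)) (h (k ∸ toℕ i)))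
  (∑-distrib-- {suc k} (λ i → f i ℤ.* h (k ∸ i)) (λ i → g i ℤ.* h (k ∸ i)))
  where
  lemma : ∀ x y z → (x ℤ.- y) ℤ.* z ≡ x ℤ.* z ℤ.- y ℤ.* z
  lemma = solve-∀

shift-· : ∀ m f g → shift m f · g ≗ shift m (f · g)
shift-· zero    f g k       = refl
shift-· (suc m) f g zero    = trans (ℤ.+-identityʳ (0ℤ ℤ.* g 0)) (ℤ.*-zeroˡ (g 0))
shift-· (suc m) f g (suc k) = begin
  0ℤ ℤ.* g (suc k) ℤ.+ (shift m f · g) k  ≡⟨ cong (ℤ._+ (shift m f · g) k) (ℤ.*-zeroˡ (g (suc k))) ⟩
  0ℤ ℤ.+ (shift m f · g) k                ≡⟨ ℤ.+-identityˡ _ ⟩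
  (shift m f · g) k                       ≡⟨ shift-· m f g k ⟩
  shift m (f · g) k                       ∎

·-shift : ∀ m f g → f · shift m g ≗ shift m (f · g)
·-shift zero    f g k    = refl
·-shift (suc m) f g zero = trans (ℤ.+-identityʳ (f 0 ℤ.* 0ℤ)) (ℤ.*-zeroʳ (f 0))
·-shift (suc m) f g (suc k) = trans (step f k) (·-shift m f g k)
  where
  -- The induction varies `f`: removing the first term of the sum leaves the product with `f ∘ suc`,
  -- one degree lower. The extra last term vanishes because it contains the constant coefficient of
  -- a properly shifted series.
  step : ∀ f k → (f · shift (suc m) g) (suc k) ≡ (f · shift m g) k
  step f zero    = cong (λ x → f 0 ℤ.* shift m g 0 ℤ.+ x)
                     (trans (ℤ.+-identityʳ (f 1 ℤ.* 0ℤ)) (ℤ.*-zeroʳ (f 1)))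
  step f (suc k) = cong (λ x → f 0 ℤ.* shift m g (suc k) ℤ.+ x) (step (f ∘ suc) k)

0-· : ∀ f k → ((λ _ → 0ℤ) · f) k ≡ 0ℤ
0-· f zero    = trans (ℤ.+-identityʳ (0ℤ ℤ.* f 0)) (ℤ.*-zeroˡ (f 0))
0-· f (suc k) = cong₂ ℤ._+_ (ℤ.*-zeroˡ (f (suc k))) (0-· f k)

·-identityˡ : ∀ f → q^ 0 · f ≗ f
·-identityˡ f zero    = trans (ℤ.+-identityʳ (1ℤ ℤ.* f 0)) (ℤ.*-identityˡ (f 0))
·-identityˡ f (suc k) = trans
  (cong₂ ℤ._+_ (ℤ.*-identityˡ (f (suc k))) (0-· f k))
  (ℤ.+-identityʳ (f (suc k)))

·-identityʳ : ∀ f → f · q^ 0 ≗ f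
·-identityʳ f zero    = trans (ℤ.+-identityʳ (f 0 ℤ.* 1ℤ)) (ℤ.*-identityʳ (f 0))
·-identityʳ f (suc k) = trans
  (cong₂ ℤ._+_ (ℤ.*-zeroʳ (f 0)) (·-identityʳ (f ∘ suc) k))
  (ℤ.+-identityˡ (f (suc k)))

q^-· : ∀ m f → q^ m · f ≗ shift m f
q^-· m f k = begin
  (q^ m · f) k             ≡⟨ ·-cong {g = f} q^m≗shift (λ _ → refl) k ⟩
  (shift m (q^ 0) · f) k   ≡⟨ shift-· m (q^ 0) f k ⟩
  shift m (q^ 0 · f) k     ≡⟨ shift-cong m (·-identityˡ f) k ⟩
  shift m f k              ∎
  where
  q^m≗shift : q^ m ≗ shift m (q^ 0)
  q^m≗shift j = begin
    (q^ m) j           ≡⟨ cong (λ l → (q^ l) j) (ℕ.+-identityʳ m) ⟨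
    (q^ (m + 0)) j     ≡⟨ shift-q^ m 0 j ⟨
    shift m (q^ 0) j   ∎

1-q^-· : ∀ m f → (1-q^ m) · f ≗ f ⊖ shift m f
1-q^-· m f k = trans (·-distribʳ-⊖ f (q^ 0) (q^ m) k)
                     (cong₂ ℤ._-_ (·-identityˡ f k) (q^-· m f k))

-- Division by 1 - qⁱ.

shift-+ : ∀ m f k → shift m f (m + k) ≡ f k
shift-+ zero    f k = refl
shift-+ (suc m) f k = shift-+ m f k

shift-< : ∀ {m k} f → k < m → shift m f k ≡ 0ℤ
shift-< {suc m} {zero}  f _             = refl
shift-< {suc m} {suc k} f (s≤s k<m) = shift-< f k<m

-- Divisibility of k by i + 1 has period i + 1 in k, so from k = i + 1 on the two coefficients
-- cancel; below that, only k = 0 is a multiple.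
geometric-inverse : ∀ i → 1/[1-q^ suc i ] ⊖ shift (suc i) 1/[1-q^ suc i ] ≗ q^ 0
geometric-inverse i k with ℕ.<-≤-connex k (suc i)
geometric-inverse i zero    | _ = refl
geometric-inverse i (suc k) | inj₁ k<i
  rewrite dec-false (suc i ∣? suc k) (>⇒∤ k<i) | shift-< 1/[1-q^ suc i ] k<i = refl
geometric-inverse i (suc k) | inj₂ i≤k with ℕ.m≤n⇒∃[o]m+o≡n i≤k
... | j , refl = begin
  1/[1-q^ suc i ] (suc i + j) ℤ.- shift (suc i) 1/[1-q^ suc i ] (suc i + j)
    ≡⟨ cong₂ ℤ._-_ (cong (if_then 1ℤ else 0ℤ) periodic) (shift-+ (suc i) 1/[1-q^ suc i ] j) ⟩
  1/[1-q^ suc i ] j ℤ.- 1/[1-q^ suc i ] j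
    ≡⟨ ℤ.+-inverseʳ (1/[1-q^ suc i ] j) ⟩
  0ℤ ∎
  where
  periodic : does (suc i ∣? (suc i + j)) ≡ does (suc i ∣? j)
  periodic = does-⇔ (mk⇔ (λ p → ∣m+n∣m⇒∣n p ∣-refl) (∣m∣n⇒∣m+n ∣-refl))
                    (suc i ∣? (suc i + j)) (suc i ∣? j)

-- The hypothesis reads (1 - q^(i+1)) g = (1 - q^m) f. In the product of `f` with the geometric
-- series, the factor 1 - q^m moves onto `f`, becomes 1 - q^(i+1) on `g` by the hypothesis, and
-- moves back onto the geometric series, which it cancels.
·-quotient : ∀ f g m i → g ⊖ shift (suc i) g ≗ f ⊖ shift m f →
             f · ((1-q^ m) · 1/[1-q^ suc i ]) ≗ g
·-quotient f g m i eq k = begin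
  (f · ((1-q^ m) · p)) k                 ≡⟨ ·-cong {f} (λ _ → refl) (1-q^-· m p) k ⟩
  (f · (p ⊖ shift m p)) k                ≡⟨ transfer f m k ⟩
  ((f ⊖ shift m f) · p) k                ≡⟨ ·-cong {g = p} (sym ∘ eq) (λ _ → refl) k ⟩
  ((g ⊖ shift (suc i) g) · p) k          ≡⟨ transfer g (suc i) k ⟨
  (g · (p ⊖ shift (suc i) p)) k          ≡⟨ ·-cong {g} (λ _ → refl) (geometric-inverse i) k ⟩
  (g · q^ 0) k                           ≡⟨ ·-identityʳ g k ⟩
  g k                                    ∎
  where
  p = 1/[1-q^ suc i ]
  transfer : ∀ f m → f · (p ⊖ shift m p) ≗ (f ⊖ shift m f) · p
  transfer f m k = begin
    (f · (p ⊖ shift m p)) k               ≡⟨ ·-distribˡ-⊖ f p (shift m p) k ⟩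
    (f · p) k ℤ.- (f · shift m p) k       ≡⟨ cong (λ x → (f · p) k ℤ.- x)
                                                  (trans (·-shift m f p k) (sym (shift-· m f p k))) ⟩
    (f · p) k ℤ.- (shift m f · p) k       ≡⟨ ·-distribʳ-⊖ p f (shift m f) k ⟨
    ((f ⊖ shift m f) · p) k               ∎

-- The two q-Pascal recurrences and the Gaussian binomial.

pascal : ℕ → ℕ → Series
pascal e       zero    = q^ 0
pascal zero    (suc d) = q^ 0
pascal (suc e) (suc d) = shift (suc e) (pascal (suc e) d) ⊕ pascal e (suc d)

pascal-zeroˡ : ∀ d → pascal 0 d ≡ q^ 0
pascal-zeroˡ zero    = refl
pascal-zeroˡ (suc d) = refl

-- In terms of words, a final a takes part in no occurrence, and a final b in one with each of the d
-- + 1 letters a. The proof is by induction: expand the terms of the first-letter recurrence by the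
-- last-letter one, then regroup by the first letter.
pascal-lastLetter : ∀ e d →
  pascal (suc e) (suc d) ≗ pascal (suc e) d ⊕ shift (suc d) (pascal e (suc d))
pascal-lastLetter zero zero k = ℤ.+-comm (shift 1 (q^ 0) k) ((q^ 0) k)
pascal-lastLetter zero (suc d) k = begin
  shift 1 (pascal 1 (suc d)) k ℤ.+ (q^ 0) k
    ≡⟨ cong (ℤ._+ (q^ 0) k) (shift-cong 1 (pascal-lastLetter zero d) k) ⟩
  shift 1 (pascal 1 d ⊕ shift (suc d) (q^ 0)) k ℤ.+ (q^ 0) k
    ≡⟨ cong (ℤ._+ (q^ 0) k) (trans
         (shift-⊕ 1 (pascal 1 d) _ k)
         (cong (λ x → shift 1 (pascal 1 d) k ℤ.+ x) (shift-shift 1 (suc d) (q^ 0) k))) ⟩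
  shift 1 (pascal 1 d) k ℤ.+ shift (2 + d) (q^ 0) k ℤ.+ (q^ 0) k
    ≡⟨ lemma (shift 1 (pascal 1 d) k) _ _ ⟩
  shift 1 (pascal 1 d) k ℤ.+ (q^ 0) k ℤ.+ shift (2 + d) (q^ 0) k ∎
  where
  lemma : ∀ x y z → x ℤ.+ y ℤ.+ z ≡ x ℤ.+ z ℤ.+ y
  lemma = solve-∀
pascal-lastLetter (suc e) zero k = begin
  shift (2 + e) (q^ 0) k ℤ.+ pascal (suc e) 1 k
    ≡⟨ cong (λ x → shift (2 + e) (q^ 0) k ℤ.+ x) (pascal-lastLetter e zero k) ⟩
  shift (2 + e) (q^ 0) k ℤ.+ ((q^ 0) k ℤ.+ shift 1 (pascal e 1) k)
    ≡⟨ lemma (shift (2 + e) (q^ 0) k) ((q^ 0) k) _ ⟩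
  (q^ 0) k ℤ.+ (shift (2 + e) (q^ 0) k ℤ.+ shift 1 (pascal e 1) k)
    ≡⟨ cong (λ x → (q^ 0) k ℤ.+ x) (trans
         (shift-⊕ 1 (shift (suc e) (q^ 0)) (pascal e 1) k)
         (cong (ℤ._+ shift 1 (pascal e 1) k) (shift-shift 1 (suc e) (q^ 0) k))) ⟨
  (q^ 0) k ℤ.+ shift 1 (pascal (suc e) 1) k ∎
  where
  lemma : ∀ x y z → x ℤ.+ (y ℤ.+ z) ≡ y ℤ.+ (x ℤ.+ z)
  lemma = solve-∀
pascal-lastLetter (suc e) (suc d) k = begin
  shift (2 + e) (pascal (2 + e) (suc d)) k ℤ.+ pascal (suc e) (2 + d) k
    ≡⟨ cong₂ ℤ._+_ (shift-cong (2 + e) (pascal-lastLetter (suc e) d) k)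
                   (pascal-lastLetter e (suc d) k) ⟩
  shift (2 + e) (pascal (2 + e) d ⊕ shift (suc d) (pascal (suc e) (suc d))) k ℤ.+
    (pascal (suc e) (suc d) k ℤ.+ shift (2 + d) (pascal e (2 + d)) k)
    ≡⟨ cong (ℤ._+ (pascal (suc e) (suc d) k ℤ.+ shift (2 + d) (pascal e (2 + d)) k))
         (shift-⊕ (2 + e) (pascal (2 + e) d) _ k) ⟩
  shift (2 + e) (pascal (2 + e) d) k ℤ.+ shift (2 + e) (shift (suc d) (pascal (suc e) (suc d))) k ℤ.+
    (pascal (suc e) (suc d) k ℤ.+ shift (2 + d) (pascal e (2 + d)) k)
    ≡⟨ lemma (shift (2 + e) (pascal (2 + e) d) k) _ _ _ ⟩
  shift (2 + e) (pascal (2 + e) d) k ℤ.+ pascal (suc e) (suc d) k ℤ.+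
    (shift (2 + e) (shift (suc d) (pascal (suc e) (suc d))) k ℤ.+ shift (2 + d) (pascal e (2 + d)) k)
    -- The first two terms are `pascal (2 + e) (suc d)` by definition. The two orders of shifting
    -- `pascal (suc e) (suc d)` agree, as both exponents add up to e + d + 3.
    ≡⟨ cong (λ x → pascal (2 + e) (suc d) k ℤ.+ (x ℤ.+ shift (2 + d) (pascal e (2 + d)) k)) swap ⟩
  pascal (2 + e) (suc d) k ℤ.+
    (shift (2 + d) (shift (suc e) (pascal (suc e) (suc d))) k ℤ.+ shift (2 + d) (pascal e (2 + d)) k)
    ≡⟨ cong (λ x → pascal (2 + e) (suc d) k ℤ.+ x)
         (shift-⊕ (2 + d) (shift (suc e) (pascal (suc e) (suc d))) _ k) ⟨
  pascal (2 + e) (suc d) k ℤ.+ shift (2 + d) (pascal (suc e) (2 + d)) k ∎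
  where
  lemma : ∀ w x y z → w ℤ.+ x ℤ.+ (y ℤ.+ z) ≡ w ℤ.+ y ℤ.+ (x ℤ.+ z)
  lemma = solve-∀
  swap : shift (2 + e) (shift (suc d) (pascal (suc e) (suc d))) k ≡
         shift (2 + d) (shift (suc e) (pascal (suc e) (suc d))) k
  swap = trans (shift-shift (2 + e) (suc d) _ k) (trans
    (cong (λ m → shift m (pascal (suc e) (suc d)) k)
      (cong (λ m → 2 + m)
        (trans (ℕ.+-suc e d) (trans (cong suc (ℕ.+-comm e d)) (sym (ℕ.+-suc d e))))))
    (sym (shift-shift (2 + d) (suc e) _ k)))

-- Comparing the two Pascal recurrences, for the first and for the last letter,
-- eliminates the term with one b fewer.
pascal-ratio : ∀ e d →
  pascal e (suc d) ⊖ shift (suc d) (pascal e (suc d)) ≗ pascal e d ⊖ shift (e + suc d) (pascal e d)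
pascal-ratio zero    d k rewrite pascal-zeroˡ d = refl
pascal-ratio (suc e) d k = begin
  pascal (suc e) (suc d) k ℤ.- shift (suc d) (shift (suc e) (pascal (suc e) d) ⊕ pascal e (suc d)) k
    ≡⟨ cong₂ ℤ._-_ (pascal-lastLetter e d k)
         (trans (shift-⊕ (suc d) (shift (suc e) (pascal (suc e) d)) _ k)
           (cong (ℤ._+ shift (suc d) (pascal e (suc d)) k)
             (trans (shift-shift (suc d) (suc e) _ k)
               (cong (λ m → shift m (pascal (suc e) d) k) (ℕ.+-comm (suc d) (suc e)))))) ⟩
  pascal (suc e) d k ℤ.+ shift (suc d) (pascal e (suc d)) k ℤ.-
    (shift (suc e + suc d) (pascal (suc e) d) k ℤ.+ shift (suc d) (pascal e (suc d)) k)
    ≡⟨ lemma (pascal (suc e) d k) _ _ ⟩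
  pascal (suc e) d k ℤ.- shift (suc e + suc d) (pascal (suc e) d) k ∎
  where
  lemma : ∀ x y z → x ℤ.+ y ℤ.- (z ℤ.+ y) ≡ x ℤ.- z
  lemma = solve-∀

-- Each new factor of the Gaussian product is the ratio of P(e,d+1) to P(e,d), so the partial
-- products are the successive P(e,d), starting from P(e,0) = 1.
gaussian≗pascal : ∀ e d → gaussian (e + d) d ≗ pascal e d
gaussian≗pascal e d k = trans
  (cong (λ c → (∏[1⋯ d ] λ i → (1-q^ (c + i)) · 1/[1-q^ i ]) k) (ℕ.m+n∸n≡m e d))
  (product d k)
  where
  -- The exponents have to keep the same `e` while the number of factors grows, so the difference
  -- `c ∸ d` has been evaluated to `e` before this induction.
  product : ∀ d → (∏[1⋯ d ] λ i → (1-q^ (e + i)) · 1/[1-q^ i ]) ≗ pascal e d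
  product zero    k = refl
  product (suc d) k = trans
    (·-cong {g = (1-q^ (e + suc d)) · 1/[1-q^ suc d ]} (product d) (λ _ → refl) k)
    (·-quotient (pascal e d) (pascal e (suc d)) (e + suc d) d (pascal-ratio e d) k)

-- Letter counts and the effect of a new first letter on the occurrences of ab.

∣_∣ᵦ : ∀ {n} → Word n → ℕ
∣ w ∣ᵦ = count (b ≟_) w

∣u∣ᵦ+∣u∣ₐ≡n : ∀ {n} (u : Word n) → ∣ u ∣ᵦ + ∣ u ∣ₐ ≡ n
∣u∣ᵦ+∣u∣ₐ≡n []      = refl
∣u∣ᵦ+∣u∣ₐ≡n (a ∷ u) = trans (ℕ.+-suc ∣ u ∣ᵦ ∣ u ∣ₐ) (cong suc (∣u∣ᵦ+∣u∣ₐ≡n u))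
∣u∣ᵦ+∣u∣ₐ≡n (b ∷ u) = cong suc (∣u∣ᵦ+∣u∣ₐ≡n u)

∣u∣ₐ≤n : ∀ {n} (u : Word n) → ∣ u ∣ₐ ≤ n
∣u∣ₐ≤n u = subst (∣ u ∣ₐ ≤_) (∣u∣ᵦ+∣u∣ₐ≡n u) (ℕ.m≤n+m ∣ u ∣ₐ ∣ u ∣ᵦ)

-- Only the boolean parts of the two deciders are compared; in all uses below they agree by `refl`.
length-filter-map : ∀ {A B : Set} {P : Pred B 0ℓ} {Q : Pred A 0ℓ}
  (P? : Decidable P) (Q? : Decidable Q) (f : A → B) →
  (∀ x → does (P? (f x)) ≡ does (Q? x)) →
  ∀ xs → length (filter P? (List.map f xs)) ≡ length (filter Q? xs)
length-filter-map P? Q? f eq List.[] = refl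
length-filter-map P? Q? f eq (x List.∷ xs) rewrite eq x with does (Q? x)
... | true  = cong suc (length-filter-map P? Q? f eq xs)
... | false = length-filter-map P? Q? f eq xs

length-filter-++ : ∀ {A : Set} {P : Pred A 0ℓ} (P? : Decidable P) xs ys →
  length (filter P? (xs List.++ ys)) ≡ length (filter P? xs) + length (filter P? ys)
length-filter-++ P? xs ys =
  trans (cong length (List.filter-++ P? xs ys)) (List.length-++ (filter P? xs))

allFin-suc : ∀ n → allFin (suc n) ≡ Fin.zero List.∷ List.map Fin.suc (allFin n)
allFin-suc n = cong (Fin.zero List.∷_) (sym (List.map-tabulate (λ i → i) Fin.suc))

count-b-positions : ∀ {n} (u : Word n) → length (filter (λ j → lookup u j ≟ b) (allFin n)) ≡ ∣ u ∣ᵦ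
count-b-positions []              = refl
count-b-positions {suc n} (x ∷ u) = begin
  length (filter (λ j → lookup (x ∷ u) j ≟ b) (allFin (suc n)))
    ≡⟨ cong (length ∘ filter (λ j → lookup (x ∷ u) j ≟ b)) (allFin-suc n) ⟩
  length (filter (λ j → lookup (x ∷ u) j ≟ b) (Fin.zero List.∷ List.map Fin.suc (allFin n)))
    ≡⟨ step x ⟩
  ∣ x ∷ u ∣ᵦ ∎
  where
  rest : ∀ x → length (filter (λ j → lookup (x ∷ u) j ≟ b) (List.map Fin.suc (allFin n))) ≡ ∣ u ∣ᵦ
  rest x = trans
    (length-filter-map _ (λ j → lookup u j ≟ b) Fin.suc (λ _ → refl) (allFin n))
    (count-b-positions u)
  step : ∀ x →
    length (filter (λ j → lookup (x ∷ u) j ≟ b) (Fin.zero List.∷ List.map Fin.suc (allFin n))) ≡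
    ∣ x ∷ u ∣ᵦ
  step a = rest a
  step b = cong suc (rest b)

-- Pairs whose second position is zero drop out, since no position precedes it; in the others both
-- positions go down by one. The two lists are kept separate so that the induction can consume `is`
-- alone.
tail-occurrences : ∀ {n} x (u : Word n) is js →
  length (filter (isOccurrence? (x ∷ u))
    (cartesianProduct (List.map Fin.suc is) (Fin.zero List.∷ List.map Fin.suc js))) ≡
  length (filter (isOccurrence? u) (cartesianProduct is js))
tail-occurrences x u List.[]       js = refl
tail-occurrences x u (i List.∷ is) js = begin
  length (filter P? (List.map (Fin.suc i ,_) (List.map Fin.suc js) List.++ rest))
    ≡⟨ length-filter-++ P? (List.map (Fin.suc i ,_) (List.map Fin.suc js)) rest ⟩
  length (filter P? (List.map (Fin.suc i ,_) (List.map Fin.suc js))) + length (filter P? rest)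
    ≡⟨ cong₂ _+_ (trans (trans
         (length-filter-map P? (λ j → P? (Fin.suc i , j)) (Fin.suc i ,_) (λ _ → refl)
           (List.map Fin.suc js))
         (length-filter-map _ (λ j → Q? (i , j)) Fin.suc (λ _ → refl) js))
         (sym (length-filter-map Q? _ (i ,_) (λ _ → refl) js)))
         (tail-occurrences x u is js) ⟩
  length (filter Q? (List.map (i ,_) js)) + length (filter Q? (cartesianProduct is js))
    ≡⟨ length-filter-++ Q? (List.map (i ,_) js) _ ⟨
  length (filter Q? (cartesianProduct (i List.∷ is) js)) ∎
  where
  P? = isOccurrence? (x ∷ u)
  Q? = isOccurrence? u
  rest = cartesianProduct (List.map Fin.suc is) (Fin.zero List.∷ List.map Fin.suc js)

-- The pairs are split by whether the first position is zero; the pair of two zeros is not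
-- increasing and contributes nothing.
binom-ab-∷ : ∀ {n} x (u : Word n) → binom-ab (x ∷ u) ≡
  length (filter (λ j → isOccurrence? (x ∷ u) (Fin.zero , Fin.suc j)) (allFin n)) + binom-ab u
binom-ab-∷ {n} x u = begin
  binom-ab (x ∷ u)
    ≡⟨ cong (λ is → length (filter P? (cartesianProduct is is))) (allFin-suc n) ⟩
  length (filter P? (List.map (Fin.zero ,_) (List.map Fin.suc (allFin n)) List.++ rest))
    ≡⟨ length-filter-++ P? (List.map (Fin.zero ,_) (List.map Fin.suc (allFin n))) rest ⟩
  length (filter P? (List.map (Fin.zero ,_) (List.map Fin.suc (allFin n)))) + length (filter P? rest)
    ≡⟨ cong₂ _+_ (trans
         (length-filter-map P? (λ j → P? (Fin.zero , j)) (Fin.zero ,_) (λ _ → refl)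
           (List.map Fin.suc (allFin n)))
         (length-filter-map _ _ Fin.suc (λ _ → refl) (allFin n)))
         (tail-occurrences x u (allFin n) (allFin n)) ⟩
  length (filter (λ j → P? (Fin.zero , Fin.suc j)) (allFin n)) + binom-ab u ∎
  where
  P? = isOccurrence? (x ∷ u)
  rest = cartesianProduct (List.map Fin.suc (allFin n)) (Fin.zero List.∷ List.map Fin.suc (allFin n))

binom-ab-a∷ : ∀ {n} (u : Word n) → binom-ab (a ∷ u) ≡ ∣ u ∣ᵦ + binom-ab u
binom-ab-a∷ {n} u = trans (binom-ab-∷ a u) (cong (_+ binom-ab u) (trans
  (cong length (List.filter-≐ (λ j → isOccurrence? (a ∷ u) (Fin.zero , Fin.suc j))
                              (λ j → lookup u j ≟ b)
    ((λ (_ , _ , eq) → eq) , (λ eq → z<s , refl , eq)) (allFin n)))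
  (count-b-positions u)))

binom-ab-b∷ : ∀ {n} (u : Word n) → binom-ab (b ∷ u) ≡ binom-ab u
binom-ab-b∷ {n} u = trans (binom-ab-∷ b u) (cong (_+ binom-ab u) (none (allFin n)))
  where
  none : ∀ is → length (filter (λ j → isOccurrence? (b ∷ u) (Fin.zero , Fin.suc j)) is) ≡ 0
  none List.[]       = refl
  none (_ List.∷ is) = none is

-- Sums over all words, and cardinalities as sums of indicators.

∑ʷ : ∀ {n} → (Word n → ℤ) → ℤ
∑ʷ {zero}  f = f []
∑ʷ {suc n} f = ∑ʷ (f ∘ (a ∷_)) ℤ.+ ∑ʷ (f ∘ (b ∷_))

∑ʷ-cong : ∀ {n} {f g : Word n → ℤ} → f ≗ g → ∑ʷ f ≡ ∑ʷ g
∑ʷ-cong {zero}  f≗g = f≗g []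
∑ʷ-cong {suc n} f≗g = cong₂ ℤ._+_ (∑ʷ-cong (f≗g ∘ (a ∷_))) (∑ʷ-cong (f≗g ∘ (b ∷_)))

∑ʷ-0 : ∀ n → ∑ʷ {n} (λ _ → 0ℤ) ≡ 0ℤ
∑ʷ-0 zero    = refl
∑ʷ-0 (suc n) = cong₂ ℤ._+_ (∑ʷ-0 n) (∑ʷ-0 n)

∑ʷ-shift : ∀ {n} m (f : Word n → Series) k →
  ∑ʷ (λ u → shift m (f u) k) ≡ shift m (λ j → ∑ʷ λ u → f u j) k
∑ʷ-shift     zero    f k       = refl
∑ʷ-shift {n} (suc m) f zero    = ∑ʷ-0 n
∑ʷ-shift     (suc m) f (suc k) = ∑ʷ-shift m f k

∑ʷ-∑-comm : ∀ {n} m (f : Word n → Fin m → ℤ) →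
  ∑ʷ (λ u → ∑[ i < m ] f u i) ≡ ∑[ i < m ] (∑ʷ λ u → f u i)
∑ʷ-∑-comm {zero}  m f = refl
∑ʷ-∑-comm {suc n} m f = trans
  (cong₂ ℤ._+_ (∑ʷ-∑-comm m (f ∘ (a ∷_))) (∑ʷ-∑-comm m (f ∘ (b ∷_))))
  (sym (∑-distrib-+ (λ i → ∑ʷ λ u → f (a ∷ u) i) (λ i → ∑ʷ λ u → f (b ∷ u) i)))

𝟙 : ∀ {A : Set} → Dec A → ℤ
𝟙 A? = if does A? then 1ℤ else 0ℤ

-- Splitting by the first letter makes `∃ P` a disjoint union. Irrelevance ensures that each word
-- satisfying `P` is counted once, not once per proof.
cardinality : ∀ {n} {P : Pred (Word n) 0ℓ} (P? : Decidable P) → (∀ u → Irrelevant (P u)) →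
  ∃ λ N → HasCardinality (∃ P) N × + N ≡ ∑ʷ (𝟙 ∘ P?)
cardinality {zero} {P} P? irr with P? []
... | yes p = 1 , mk↔ₛ′ (λ _ → [] , p) (λ _ → Fin.zero)
                        (λ { ([] , q) → cong ([] ,_) (irr [] p q) })
                        (λ { Fin.zero → refl ; (Fin.suc ()) }) , refl
... | no ¬p = 0 , mk↔ₛ′ (λ ()) (λ { ([] , q) → contradiction q ¬p })
                        (λ { ([] , q) → contradiction q ¬p }) (λ ()) , refl
cardinality {suc n} {P} P? irr
  with cardinality (P? ∘ (a ∷_)) (irr ∘ (a ∷_)) | cardinality (P? ∘ (b ∷_)) (irr ∘ (b ∷_))
... | M , M↔ , M≡ | N , N↔ , N≡ =
  M + N , split ↔-∘ ((M↔ ⊎-↔ N↔) ↔-∘ Fin.+↔⊎) , trans (ℤ.pos-+ M N) (cong₂ ℤ._+_ M≡ N≡)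
  where
  split : (∃ (P ∘ (a ∷_)) ⊎ ∃ (P ∘ (b ∷_))) ↔ ∃ P
  split = mk↔ₛ′
    (λ { (inj₁ (u , p)) → a ∷ u , p ; (inj₂ (u , p)) → b ∷ u , p })
    (λ { (a ∷ u , p) → inj₁ (u , p) ; (b ∷ u , p) → inj₂ (u , p) })
    (λ { (a ∷ u , p) → refl ; (b ∷ u , p) → refl })
    (λ { (inj₁ (u , p)) → refl ; (inj₂ (u , p)) → refl })

-- The generating function of `binom-ab` at a fixed number of letters a.

weight : ∀ {n} → ℕ → Word n → Series
weight d u = if does (∣ u ∣ₐ ℕ.≟ d) then q^ binom-ab u else λ _ → 0ℤ

-- If `u` has d letters a, it has e letters b, and the leading a forms an occurrence with each of
-- them; otherwise both sides vanish.
weight-a∷ : ∀ {n} e d (u : Word n) → e + d ≡ n → weight (suc d) (a ∷ u) ≗ shift e (weight d u)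
weight-a∷ {n} e d u e+d≡n k with ∣ u ∣ₐ ℕ.≟ d
... | no ∣u∣ₐ≢d rewrite dec-false (∣ u ∣ₐ ℕ.≟ d) ∣u∣ₐ≢d = sym (shift-0 e k)
... | yes ∣u∣ₐ≡d rewrite dec-true (∣ u ∣ₐ ℕ.≟ d) ∣u∣ₐ≡d = begin
  (q^ binom-ab (a ∷ u)) k         ≡⟨ cong (λ m → (q^ m) k)
                                       (trans (binom-ab-a∷ u) (cong (_+ binom-ab u) ∣u∣ᵦ≡e)) ⟩
  (q^ (e + binom-ab u)) k         ≡⟨ shift-q^ e (binom-ab u) k ⟨
  shift e (q^ binom-ab u) k       ∎
  where
  ∣u∣ᵦ≡e : ∣ u ∣ᵦ ≡ e
  ∣u∣ᵦ≡e = ℕ.+-cancelʳ-≡ d ∣ u ∣ᵦ e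
    (trans (cong (λ m → ∣ u ∣ᵦ + m) (sym ∣u∣ₐ≡d)) (trans (∣u∣ᵦ+∣u∣ₐ≡n u) (sym e+d≡n)))

weight-b∷ : ∀ {n} d (u : Word n) → weight d (b ∷ u) ≗ weight d u
weight-b∷ d u k rewrite binom-ab-b∷ u = refl

weight-> : ∀ {n} d (u : Word n) → n < d → ∀ k → weight d u k ≡ 0ℤ
weight-> d u n<d k rewrite dec-false (∣ u ∣ₐ ℕ.≟ d) (ℕ.<⇒≢ (ℕ.≤-<-trans (∣u∣ₐ≤n u) n<d)) = refl

-- Splitting by the first letter reproduces the recurrence that defines `pascal`; at each boundary
-- one of the two letters contributes nothing.
∑ʷ-weight : ∀ n e d → e + d ≡ n → ∀ k → ∑ʷ {n} (λ u → weight d u k) ≡ pascal e d k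
∑ʷ-weight zero    zero    zero    eq k = refl
∑ʷ-weight (suc n) zero    (suc d) eq k = begin
  ∑ʷ {n} (λ u → weight (suc d) (a ∷ u) k) ℤ.+ ∑ʷ {n} (λ u → weight (suc d) (b ∷ u) k)
    ≡⟨ cong₂ ℤ._+_ (∑ʷ-cong {n} (λ u → weight-a∷ 0 d u (ℕ.suc-injective eq) k))
                   -- After a leading b only n = d letters remain, too few for d + 1 letters a.
                   (trans (∑ʷ-cong {n} (λ u → trans (weight-b∷ (suc d) u k)
                                                    (weight-> (suc d) u (ℕ.≤-reflexive (sym eq)) k)))
                          (∑ʷ-0 n)) ⟩
  ∑ʷ {n} (λ u → weight d u k) ℤ.+ 0ℤ
    ≡⟨ ℤ.+-identityʳ _ ⟩
  ∑ʷ {n} (λ u → weight d u k)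
    ≡⟨ ∑ʷ-weight n 0 d (ℕ.suc-injective eq) k ⟩
  pascal 0 d k
    ≡⟨ cong (λ f → f k) (pascal-zeroˡ d) ⟩
  (q^ 0) k ∎
∑ʷ-weight (suc n) (suc e) zero    eq k = begin
  ∑ʷ {n} (λ _ → 0ℤ) ℤ.+ ∑ʷ {n} (λ u → weight 0 (b ∷ u) k)
    ≡⟨ cong₂ ℤ._+_ (∑ʷ-0 n)
         (trans (∑ʷ-cong {n} (λ u → weight-b∷ 0 u k)) (∑ʷ-weight n e 0 (ℕ.suc-injective eq) k)) ⟩
  0ℤ ℤ.+ (q^ 0) k
    ≡⟨ ℤ.+-identityˡ _ ⟩
  (q^ 0) k ∎
∑ʷ-weight (suc n) (suc e) (suc d) eq k = cong₂ ℤ._+_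
  (begin
    ∑ʷ {n} (λ u → weight (suc d) (a ∷ u) k)
      ≡⟨ ∑ʷ-cong {n} (λ u → weight-a∷ (suc e) d u eq′ k) ⟩
    ∑ʷ {n} (λ u → shift (suc e) (weight d u) k)
      ≡⟨ ∑ʷ-shift {n} (suc e) (weight d) k ⟩
    shift (suc e) (λ j → ∑ʷ {n} λ u → weight d u j) k
      ≡⟨ shift-cong (suc e) (∑ʷ-weight n (suc e) d eq′) k ⟩
    shift (suc e) (pascal (suc e) d) k ∎)
  (trans (∑ʷ-cong {n} (λ u → weight-b∷ (suc d) u k))
         (∑ʷ-weight n e (suc d) (ℕ.suc-injective eq) k))
  where
  eq′ : suc e + d ≡ n
  eq′ = trans (sym (ℕ.+-suc e d)) (ℕ.suc-injective eq)

-- Blocks of consecutive exponents with a common quotient.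

strip-suc : ∀ {n m} (u : Word n) → ∣ u ∣ₐ ≡ suc m → strip u ≡ binom-ab u / suc m
strip-suc u eq with ∣ u ∣ₐ | eq
... | suc m | refl = refl

-- The exponent y + r is met exactly once among the m consecutive ones from y on. Recursion removes
-- the common offset y, then walks r places to the hit.
∑-q^-+ : ∀ m y r → r < m → ∑[ i < m ] ((q^ (y + r)) (y + toℕ i)) ≡ 1ℤ
∑-q^-+ m       (suc y) r       r<m       = ∑-q^-+ m y r r<m
∑-q^-+ (suc m) zero    zero    _         = cong (λ x → 1ℤ ℤ.+ x) (sum-replicate-zero m)
∑-q^-+ (suc m) zero    (suc r) (s≤s r<m) = trans (ℤ.+-identityˡ _) (∑-q^-+ m zero r r<m)

[m*s+i]/m≡s : ∀ m s i → i < suc m → (suc m * s + i) / suc m ≡ s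
[m*s+i]/m≡s m s i i<m = begin
  (suc m * s + i) / suc m            ≡⟨ +-distrib-/-∣ˡ i (m∣m*n s) ⟩
  suc m * s / suc m + i / suc m      ≡⟨ cong₂ _+_
                                          (trans (cong (_/ suc m) (ℕ.*-comm (suc m) s)) (m*n/n≡m s (suc m)))
                                          (m<n⇒m/n≡0 i<m) ⟩
  s + 0                              ≡⟨ ℕ.+-identityʳ s ⟩
  s                                  ∎

-- Division by m + 1 cuts the naturals into blocks of that length. Block s contains x exactly when
-- the quotient of x is s, and then the remainder is its place in the block.
∑-q^-quotient : ∀ m x s → ∑[ i < suc m ] ((q^ x) (suc m * s + toℕ i)) ≡ 𝟙 (x / suc m ℕ.≟ s)
∑-q^-quotient m x s with x / suc m ℕ.≟ s
... | yes refl rewrite dec-true (x / suc m ℕ.≟ s) refl = begin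
  ∑[ i < suc m ] ((q^ x) (suc m * s + toℕ i))
    ≡⟨ cong (λ y → ∑[ i < suc m ] ((q^ y) (suc m * s + toℕ i))) x≡ ⟩
  ∑[ i < suc m ] ((q^ (suc m * s + x % suc m)) (suc m * s + toℕ i))
    ≡⟨ ∑-q^-+ (suc m) (suc m * s) (x % suc m) (m%n<n x (suc m)) ⟩
  1ℤ ∎
  where
  x≡ : x ≡ suc m * s + x % suc m
  x≡ = trans (m≡m%n+[m/n]*n x (suc m))
    (trans (ℕ.+-comm (x % suc m) _) (cong (_+ x % suc m) (ℕ.*-comm s (suc m))))
... | no x/m≢s rewrite dec-false (x / suc m ℕ.≟ s) x/m≢s = begin
  ∑[ i < suc m ] ((q^ x) (suc m * s + toℕ i))
    ≡⟨ sum-cong-≗ {suc m} (λ i → cong (if_then 1ℤ else 0ℤ)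
         (dec-false (suc m * s + toℕ i ℕ.≟ x) λ { refl →
           x/m≢s ([m*s+i]/m≡s m s (toℕ i) (Fin.toℕ<n i)) })) ⟩
  ∑[ i < suc m ] 0ℤ
    ≡⟨ sum-replicate-zero (suc m) ⟩
  0ℤ ∎

-- The size of a class as a sum of coefficients.

_∼?_ : ∀ {n} (u w : Word n) → Dec (u ∼ w)
u ∼? w = (∣ u ∣ₐ ℕ.≟ ∣ w ∣ₐ) ×-dec (strip u ℕ.≟ strip w)

∼-irrelevant : ∀ {n} (u w : Word n) → Irrelevant (u ∼ w)
∼-irrelevant u w (p , q) (p′ , q′) = cong₂ _,_ (ℕ.≡-irrelevant p p′) (ℕ.≡-irrelevant q q′)

𝟙-∼ : ∀ {n} (u w : Word n) → 0 < ∣ w ∣ₐ →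
  𝟙 (u ∼? w) ≡ ∑[ i < ∣ w ∣ₐ ] weight ∣ w ∣ₐ u (∣ w ∣ₐ * strip w + toℕ i)
𝟙-∼ u w 0<∣w∣ₐ with ∣ u ∣ₐ ℕ.≟ ∣ w ∣ₐ
... | no  ∣u∣≢∣w∣ rewrite dec-false (∣ u ∣ₐ ℕ.≟ ∣ w ∣ₐ) ∣u∣≢∣w∣ = sym (sum-replicate-zero ∣ w ∣ₐ)
... | yes ∣u∣≡∣w∣ rewrite dec-true (∣ u ∣ₐ ℕ.≟ ∣ w ∣ₐ) ∣u∣≡∣w∣ = go ∣ w ∣ₐ 0<∣w∣ₐ ∣u∣≡∣w∣
  where
  -- The number of letters a is generalised to `m` so that it can be matched as a successor, the
  -- case in which `strip` is a division.
  go : ∀ m → 0 < m → ∣ u ∣ₐ ≡ m →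
    𝟙 (strip u ℕ.≟ strip w) ≡ ∑[ i < m ] ((q^ binom-ab u) (m * strip w + toℕ i))
  go (suc m) _ eq = trans (cong (λ s → 𝟙 (s ℕ.≟ strip w)) (strip-suc u eq))
                          (sym (∑-q^-quotient m (binom-ab u) (strip w)))

proposition10 : ∀ (n : ℕ) (w : Word n) → 0 < ∣ w ∣ₐ →
    ∃ λ (N : ℕ) → HasCardinality [ w ]∼ N ×
    + N ≡ ∑[ i < ∣ w ∣ₐ ] ([q^ ∣ w ∣ₐ * strip w + toℕ i ] gaussian n ∣ w ∣ₐ)
proposition10 n w 0<∣w∣ₐ with cardinality (_∼? w) (λ u → ∼-irrelevant u w)
... | N , N↔ , N≡ = N , N↔ , (begin
  + N
    ≡⟨ N≡ ⟩
  ∑ʷ (λ u → 𝟙 (u ∼? w))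
    ≡⟨ ∑ʷ-cong {n} (λ u → 𝟙-∼ u w 0<∣w∣ₐ) ⟩
  ∑ʷ {n} (λ u → ∑[ i < m ] weight m u (m * strip w + toℕ i))
    -- Exchanging the sums leaves one coefficient of the generating function for each exponent in
    -- the block.
    ≡⟨ ∑ʷ-∑-comm {n} m (λ u i → weight m u (m * strip w + toℕ i)) ⟩
  ∑[ i < m ] (∑ʷ {n} λ u → weight m u (m * strip w + toℕ i))
    ≡⟨ sum-cong-≗ {m} (λ i → coefficient (m * strip w + toℕ i)) ⟩
  ∑[ i < m ] ([q^ m * strip w + toℕ i ] gaussian n m) ∎)
  where
  m = ∣ w ∣ₐ
  -- The word `w` itself supplies the decomposition of n as `∣ w ∣ᵦ + m`, hence m ≤ n, the range in
  -- which `gaussian n m` is meaningful.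
  coefficient : ∀ k → ∑ʷ {n} (λ u → weight m u k) ≡ ([q^ k ] gaussian n m)
  coefficient k = begin
    ∑ʷ {n} (λ u → weight m u k)              ≡⟨ ∑ʷ-weight n ∣ w ∣ᵦ m (∣u∣ᵦ+∣u∣ₐ≡n w) k ⟩
    pascal ∣ w ∣ᵦ m k                    ≡⟨ gaussian≗pascal ∣ w ∣ᵦ m k ⟨
    gaussian (∣ w ∣ᵦ + m) m k            ≡⟨ cong (λ c → gaussian c m k) (∣u∣ᵦ+∣u∣ₐ≡n w) ⟩
    gaussian n m k                       ∎
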